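{- If $\mathsf L$ is a locally tabular intermediate logic with finitary or unitary unification and $\mathsf L'$ is an intermediate logic with projective unification, then $\mathsf L\cap\mathsf L'$ has finitary or unitary unification.
   Context: An intermediate logic is a set of intuitionistic propositional formulas containing $\mathsf{INT}$, closed under modus ponens and substitution; it is locally tabular if for each $n$ there are only finitely many formulas in variables $x_1,\dots,x_n$ up to $\mathsf L$-provable equivalence. A substitution $\varepsilon$ is an $\mathsf L$-unifier of $A$ if $\varepsilon(A)\in\mathsf L$; $\varepsilon\preccurlyeq\mu$ iff $\alpha\circ\varepsilon=_{\mathsf L}\mu$ for some $\alpha$. Unification is unitary if every unifiable formula has a unifier $\preccurlyeq$ all its unifiers, finitary if not unitary and every unifiable formula has a finite complete set of unifiers (each unifier is $\succcurlyeq$ some member). An $\mathsf L$-unifier $\varepsilon$ of $A$ is projective if $A\vdash_{\mathsf L}\varepsilon(x)\leftrightarrow x$ for every variable $x$; $\mathsf L'$ has projective unification if every $\mathsf L'$-unifiable formula has a projective $\mathsf L'$-unifier. -}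

module Defs where

open import Data.Nat using (ℕ; _<_)
open import Data.Product using (Σ; _×_; _,_; ∃)
open import Data.Sum using (_⊎_)
open import Data.List using (List)
open import Data.List.Membership.Propositional using (_∈_)
open import Relation.Nullary using (¬_)
open import Data.Empty using (⊥)
open import Data.Unit using (⊤)

infixr 6 _∧_
infixr 5 _∨_
infixr 4 _⇒_
infix  3 _⇔_

data Fm : Set where
  var  : ℕ → Fm
  ⊥'   : Fm
  _∧_  : Fm → Fm → Fm
  _∨_  : Fm → Fm → Fm
  _⇒_  : Fm → Fm → Fm

_⇔_ : Fm → Fm → Fm
A ⇔ B = (A ⇒ B) ∧ (B ⇒ A)

Subst : Set
Subst = ℕ → Fm

sub : Subst → Fm → Fm
sub σ (var x)  = σ x
sub σ ⊥'       = ⊥'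
sub σ (A ∧ B)  = sub σ A ∧ sub σ B
sub σ (A ∨ B)  = sub σ A ∨ sub σ B
sub σ (A ⇒ B)  = sub σ A ⇒ sub σ B

_∘ˢ_ : Subst → Subst → Subst
(α ∘ˢ ε) x = sub α (ε x)

data INT : Fm → Set where
  ax-K   : ∀ A B → INT (A ⇒ B ⇒ A)
  ax-S   : ∀ A B C → INT ((A ⇒ B ⇒ C) ⇒ (A ⇒ B) ⇒ A ⇒ C)
  ax-∧E₁ : ∀ A B → INT (A ∧ B ⇒ A)
  ax-∧E₂ : ∀ A B → INT (A ∧ B ⇒ B)
  ax-∧I  : ∀ A B → INT (A ⇒ B ⇒ A ∧ B)
  ax-∨I₁ : ∀ A B → INT (A ⇒ A ∨ B)
  ax-∨I₂ : ∀ A B → INT (B ⇒ A ∨ B)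
  ax-∨E  : ∀ A B C → INT ((A ⇒ C) ⇒ (B ⇒ C) ⇒ A ∨ B ⇒ C)
  ax-⊥E  : ∀ A → INT (⊥' ⇒ A)
  mp     : ∀ {A B} → INT A → INT (A ⇒ B) → INT B

Logic : Set₁
Logic = Fm → Set

record IntermediateLogic (L : Logic) : Set where
  field
    contains-INT : ∀ A → INT A → L A
    closed-MP    : ∀ A B → L A → L (A ⇒ B) → L B
    closed-sub   : ∀ (σ : Subst) A → L A → L (sub σ A)

_∩_ : Logic → Logic → Logic
(L ∩ L') A = L A × L' A

VarsBelow : ℕ → Fm → Set
VarsBelow n (var x)  = x < n
VarsBelow n ⊥'       = ⊤
VarsBelow n (A ∧ B)  = VarsBelow n A × VarsBelow n B
VarsBelow n (A ∨ B)  = VarsBelow n A × VarsBelow n B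
VarsBelow n (A ⇒ B)  = VarsBelow n A × VarsBelow n B

LocallyTabular : Logic → Set
LocallyTabular L = ∀ (n : ℕ) → Σ (List Fm) λ Fs →
  ∀ A → VarsBelow n A → Σ Fm λ B → B ∈ Fs × L (A ⇔ B)

Unifier : Logic → Fm → Subst → Set
Unifier L A ε = L (sub ε A)

Unifiable : Logic → Fm → Set
Unifiable L A = Σ Subst (Unifier L A)

_≼[_]_ : Subst → Logic → Subst → Set
ε ≼[ L ] μ = Σ Subst λ α → ∀ x → L ((α ∘ˢ ε) x ⇔ μ x)

MostGeneralUnifier : Logic → Fm → Subst → Set
MostGeneralUnifier L A ε = Unifier L A ε × (∀ μ → Unifier L A μ → ε ≼[ L ] μ)

CompleteSet : Logic → Fm → List Subst → Set
CompleteSet L A Es =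
  (∀ {ε} → ε ∈ Es → Unifier L A ε) ×
  (∀ μ → Unifier L A μ → Σ Subst λ ε → ε ∈ Es × ε ≼[ L ] μ)

Unitary : Logic → Set
Unitary L = ∀ A → Unifiable L A → Σ Subst (MostGeneralUnifier L A)

Finitary : Logic → Set
Finitary L = ¬ Unitary L × (∀ A → Unifiable L A → Σ (List Subst) (CompleteSet L A))

data _⊢[_]_ (A : Fm) (L : Logic) : Fm → Set where
  hyp : A ⊢[ L ] A
  thm : ∀ {B} → L B → A ⊢[ L ] B
  mp  : ∀ {B C} → A ⊢[ L ] B → A ⊢[ L ] (B ⇒ C) → A ⊢[ L ] C

Projective : Logic → Fm → Subst → Set
Projective L A ε = Unifier L A ε × (∀ x → A ⊢[ L ] (ε x ⇔ var x))

ProjectiveUnification : Logic → Set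
ProjectiveUnification L = ∀ A → Unifiable L A → Σ Subst (Projective L A)

{-# OPTIONS --safe #-}
-- Projective unification makes L' an extension of Gödel–Dummett logic. Evaluating the
-- theorems of L in the Gödel algebra ℕ ∪ {∞} and picking D ∈ L with the least value, every
-- theorem of L is implied in L' by an instance of D: one theorem of L controls L + L' over L'.
-- Given an L-unifier ε of A, take three disjoint sorts of variables: X for those of A, Y for
-- the values of ε, Z for D. Let π be a projective L'-unifier of
-- B = (D(Z) ⇒ ⋀ⱼ (Xⱼ ⇔ ε(xⱼ)(Y))) ∧ A(X). Modified by ρ so as to agree with ε over L + L',
-- it can be glued with ε to a single substitution ν that behaves like ε in L and like ρ ∘ π
-- in L'. If μ unifies A in both logics and μ = α ∘ ε in L, then sending X to μ, Y to α and
-- Z to a suitable instance of D unifies B in L', hence exhibits μ as an instance of ν. So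
-- each member of a complete set for L contributes at most one unifier to one for L ∩ L'.
module Submission where

open import Defs
open import Data.Sum using (_⊎_; inj₁; inj₂; [_,_]′)
open import Level using (0ℓ)
open import Axiom.ExcludedMiddle using (ExcludedMiddle)
open import Data.Nat using (ℕ; zero; suc; _≤_; _<_; _≤′_; ≤′-refl; ≤′-step)
open import Data.Nat.Properties using (_≟_; <-cmp; <⇒≤; ≤-reflexive; ≤⇒≤′; ≮⇒≥)
open import Data.Nat.Induction using (<-rec)
open import Data.Product using (Σ; _×_; _,_; proj₁; proj₂)
open import Data.List using (List; []; _∷_; _++_; foldr)
open import Data.List.Membership.Propositional using (_∈_)
open import Data.List.Membership.Propositional.Properties using (∈-++⁺ˡ; ∈-++⁺ʳ)
open import Data.List.Membership.DecPropositional _≟_ using (_∈?_)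
open import Data.List.Relation.Unary.Any using (here; there)
open import Data.List.Relation.Unary.All as All using (All; []; _∷_)
open import Data.List.Relation.Unary.AllPairs as AllPairs using (AllPairs; []; _∷_)
open import Data.List.Relation.Binary.Permutation.Propositional
  using (_↭_; ↭-refl; ↭-trans; ↭-sym; prep; swap)
open import Data.List.Relation.Binary.Permutation.Propositional.Properties
  using (All-resp-↭; ∈-resp-↭)
open import Relation.Nullary.Construct.Add.Supremum using (_⁺; [_]; ⊤⁺)
open import Relation.Binary.Construct.Add.Supremum.NonStrict _≤_ using (_≤⁺_; [_]; _≤⊤⁺)
open import Relation.Binary.Construct.Add.Supremum.Strict _<_ using (_<⁺_; [_]; [_]<⊤⁺; <⁺-cmp-≡)
open import Relation.Binary.Definitions using (tri<; tri≈; tri>)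
open import Relation.Binary.PropositionalEquality using (_≡_; refl; sym; trans; cong; cong₂; subst)
open import Relation.Nullary using (Dec; yes; no; contradiction)
open import Function using (_∘_)

-- Finite conjunctions and the algebra of substitutions.

⊤' : Fm
⊤' = ⊥' ⇒ ⊥'

⋀ : List ℕ → (ℕ → Fm) → Fm
⋀ xs f = foldr (λ x → f x ∧_) ⊤' xs

vars : Fm → List ℕ
vars (var x) = x ∷ []
vars ⊥'      = []
vars (A ∧ B) = vars A ++ vars B
vars (A ∨ B) = vars A ++ vars B
vars (A ⇒ B) = vars A ++ vars B

sub-cong : ∀ {σ τ} A → (∀ {x} → x ∈ vars A → σ x ≡ τ x) → sub σ A ≡ sub τ A
sub-cong (var x) h = h (here refl)
sub-cong ⊥'      h = refl
sub-cong (A ∧ B) h = cong₂ _∧_ (sub-cong A (h ∘ ∈-++⁺ˡ)) (sub-cong B (h ∘ ∈-++⁺ʳ (vars A)))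
sub-cong (A ∨ B) h = cong₂ _∨_ (sub-cong A (h ∘ ∈-++⁺ˡ)) (sub-cong B (h ∘ ∈-++⁺ʳ (vars A)))
sub-cong (A ⇒ B) h = cong₂ _⇒_ (sub-cong A (h ∘ ∈-++⁺ˡ)) (sub-cong B (h ∘ ∈-++⁺ʳ (vars A)))

sub-∘ : ∀ σ τ A → sub σ (sub τ A) ≡ sub (σ ∘ˢ τ) A
sub-∘ σ τ (var x) = refl
sub-∘ σ τ ⊥'      = refl
sub-∘ σ τ (A ∧ B) = cong₂ _∧_ (sub-∘ σ τ A) (sub-∘ σ τ B)
sub-∘ σ τ (A ∨ B) = cong₂ _∨_ (sub-∘ σ τ A) (sub-∘ σ τ B)
sub-∘ σ τ (A ⇒ B) = cong₂ _⇒_ (sub-∘ σ τ A) (sub-∘ σ τ B)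

sub-var : ∀ A → sub var A ≡ A
sub-var (var x) = refl
sub-var ⊥'      = refl
sub-var (A ∧ B) = cong₂ _∧_ (sub-var A) (sub-var B)
sub-var (A ∨ B) = cong₂ _∨_ (sub-var A) (sub-var B)
sub-var (A ⇒ B) = cong₂ _⇒_ (sub-var A) (sub-var B)

sub-⋀ : ∀ σ xs f → sub σ (⋀ xs f) ≡ ⋀ xs (sub σ ∘ f)
sub-⋀ σ []       f = refl
sub-⋀ σ (x ∷ xs) f = cong (sub σ (f x) ∧_) (sub-⋀ σ xs f)

-- An element agreeing with a wherever D forces a ⇔ b, and with b under D.
glue : Fm → Fm → Fm → Fm
glue D a b = (D ⇒ b) ∧ ((D ⇒ (a ⇔ b)) ⇒ a)

-- Natural deduction inside an intermediate logic.

module Entailment {L : Logic} (IL : IntermediateLogic L) where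
  open IntermediateLogic IL public

  infix 2 _⊢_
  -- A context is one formula, extended by `∧`, so every entailment is itself a member of `L`.
  _⊢_ : Fm → Fm → Set
  Γ ⊢ A = L (Γ ⇒ A)

  MP : ∀ {A B} → L A → L (A ⇒ B) → L B
  MP = closed-MP _ _

  axiom : ∀ {A} → INT A → L A
  axiom = contains-INT _

  theorem : ∀ {Γ A} → L A → Γ ⊢ A
  theorem a = MP a (axiom (ax-K _ _))

  app : ∀ {Γ A B} → Γ ⊢ A ⇒ B → Γ ⊢ A → Γ ⊢ B
  app f a = MP a (MP f (axiom (ax-S _ _ _)))

  hyp₀ : ∀ {Γ} → Γ ⊢ Γ
  hyp₀ {Γ} = app {B = Γ} (axiom (ax-K Γ (Γ ⇒ Γ))) (axiom (ax-K Γ Γ))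

  cut : ∀ {Γ A B} → Γ ⊢ A → A ⊢ B → Γ ⊢ B
  cut a f = app (theorem f) a

  fst : ∀ {Γ A B} → Γ ⊢ A ∧ B → Γ ⊢ A
  fst p = cut p (axiom (ax-∧E₁ _ _))

  snd : ∀ {Γ A B} → Γ ⊢ A ∧ B → Γ ⊢ B
  snd p = cut p (axiom (ax-∧E₂ _ _))

  pair : ∀ {Γ A B} → Γ ⊢ A → Γ ⊢ B → Γ ⊢ A ∧ B
  pair a b = app (cut a (axiom (ax-∧I _ _))) b

  lam : ∀ {Γ A B} → Γ ∧ A ⊢ B → Γ ⊢ A ⇒ B
  lam f = app (theorem (MP (theorem f) (axiom (ax-S _ _ _)))) (axiom (ax-∧I _ _))

  wk : ∀ {Γ A B} → Γ ⊢ B → Γ ∧ A ⊢ B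
  wk = cut (axiom (ax-∧E₁ _ _))

  v₀ : ∀ {Γ A} → Γ ∧ A ⊢ A
  v₀ = axiom (ax-∧E₂ _ _)

  inl : ∀ {Γ A B} → Γ ⊢ A → Γ ⊢ A ∨ B
  inl a = cut a (axiom (ax-∨I₁ _ _))

  inr : ∀ {Γ A B} → Γ ⊢ B → Γ ⊢ A ∨ B
  inr b = cut b (axiom (ax-∨I₂ _ _))

  cases : ∀ {Γ A B C} → Γ ⊢ A ∨ B → Γ ∧ A ⊢ C → Γ ∧ B ⊢ C → Γ ⊢ C
  cases d f g = app (app (cut (lam f) (axiom (ax-∨E _ _ _))) (lam g)) d

  efq : ∀ {Γ A} → Γ ⊢ ⊥' → Γ ⊢ A
  efq b = cut b (axiom (ax-⊥E _))

  truth : ∀ {Γ} → Γ ⊢ ⊤'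
  truth = theorem (axiom (ax-⊥E _))

  proved : ∀ {A} → ⊤' ⊢ A → L A
  proved = MP (axiom (ax-⊥E _))

  substitute : ∀ σ {A} → L A → L (sub σ A)
  substitute σ = closed-sub σ _

  ⋀-elim : ∀ {xs f x} → x ∈ xs → ⋀ xs f ⊢ f x
  ⋀-elim (here refl) = fst hyp₀
  ⋀-elim (there p)   = cut (snd hyp₀) (⋀-elim p)

  ⋀-intro : ∀ {Γ f} xs → (∀ {x} → x ∈ xs → Γ ⊢ f x) → Γ ⊢ ⋀ xs f
  ⋀-intro []       h = truth
  ⋀-intro (x ∷ xs) h = pair (h (here refl)) (⋀-intro xs (h ∘ there))

  ⇔-to : ∀ {Γ A B} → Γ ⊢ A ⇔ B → Γ ⊢ A → Γ ⊢ B
  ⇔-to e = app (fst e)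

  ⇔-from : ∀ {Γ A B} → Γ ⊢ A ⇔ B → Γ ⊢ B → Γ ⊢ A
  ⇔-from e = app (snd e)

  ⇔-intro : ∀ {Γ A B} → Γ ∧ A ⊢ B → Γ ∧ B ⊢ A → Γ ⊢ A ⇔ B
  ⇔-intro f g = pair (lam f) (lam g)

  ⇔-refl : ∀ {Γ A} → Γ ⊢ A ⇔ A
  ⇔-refl = ⇔-intro v₀ v₀

  ⇔-sym : ∀ {Γ A B} → Γ ⊢ A ⇔ B → Γ ⊢ B ⇔ A
  ⇔-sym e = pair (snd e) (fst e)

  ⇔-trans : ∀ {Γ A B C} → Γ ⊢ A ⇔ B → Γ ⊢ B ⇔ C → Γ ⊢ A ⇔ C
  ⇔-trans e f = ⇔-intro (⇔-to (wk f) (⇔-to (wk e) v₀)) (⇔-from (wk e) (⇔-from (wk f) v₀))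

  ⇔-reflexive : ∀ {Γ A B} → A ≡ B → Γ ⊢ A ⇔ B
  ⇔-reflexive refl = ⇔-refl

  ∧-cong : ∀ {Γ A A′ B B′} → Γ ⊢ A ⇔ A′ → Γ ⊢ B ⇔ B′ → Γ ⊢ A ∧ B ⇔ A′ ∧ B′
  ∧-cong e f = ⇔-intro
    (pair (⇔-to (wk e) (fst v₀)) (⇔-to (wk f) (snd v₀)))
    (pair (⇔-from (wk e) (fst v₀)) (⇔-from (wk f) (snd v₀)))

  ∨-cong : ∀ {Γ A A′ B B′} → Γ ⊢ A ⇔ A′ → Γ ⊢ B ⇔ B′ → Γ ⊢ A ∨ B ⇔ A′ ∨ B′
  ∨-cong e f = ⇔-intro
    (cases v₀ (inl (⇔-to (wk (wk e)) v₀)) (inr (⇔-to (wk (wk f)) v₀)))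
    (cases v₀ (inl (⇔-from (wk (wk e)) v₀)) (inr (⇔-from (wk (wk f)) v₀)))

  ⇒-cong : ∀ {Γ A A′ B B′} → Γ ⊢ A ⇔ A′ → Γ ⊢ B ⇔ B′ → Γ ⊢ (A ⇒ B) ⇔ (A′ ⇒ B′)
  ⇒-cong e f = ⇔-intro
    (lam (⇔-to (wk (wk f)) (app (wk v₀) (⇔-from (wk (wk e)) v₀))))
    (lam (⇔-from (wk (wk f)) (app (wk v₀) (⇔-to (wk (wk e)) v₀))))

  sub-⇔ : ∀ {Γ σ τ} A → (∀ {x} → x ∈ vars A → Γ ⊢ σ x ⇔ τ x) → Γ ⊢ sub σ A ⇔ sub τ A
  sub-⇔ (var x) h = h (here refl)
  sub-⇔ ⊥'      h = ⇔-refl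
  sub-⇔ (A ∧ B) h = ∧-cong (sub-⇔ A (h ∘ ∈-++⁺ˡ)) (sub-⇔ B (h ∘ ∈-++⁺ʳ (vars A)))
  sub-⇔ (A ∨ B) h = ∨-cong (sub-⇔ A (h ∘ ∈-++⁺ˡ)) (sub-⇔ B (h ∘ ∈-++⁺ʳ (vars A)))
  sub-⇔ (A ⇒ B) h = ⇒-cong (sub-⇔ A (h ∘ ∈-++⁺ˡ)) (sub-⇔ B (h ∘ ∈-++⁺ʳ (vars A)))

  glue-right : ∀ {Γ D a b} → Γ ⊢ D → Γ ⊢ glue D a b ⇔ b
  glue-right d = ⇔-intro
    (app (fst v₀) (wk d))
    (pair (lam (wk v₀)) (lam (⇔-from (app v₀ (wk (wk d))) (wk v₀))))

  glue-left : ∀ {Γ D a b} → Γ ⊢ D ⇒ (a ⇔ b) → Γ ⊢ glue D a b ⇔ a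
  glue-left e = ⇔-intro
    (app (snd v₀) (wk e))
    (pair (lam (⇔-to (app (wk (wk e)) v₀) (wk v₀))) (lam (wk v₀)))

  deduction : ∀ {A B} → A ⊢[ L ] B → A ⊢ B
  deduction hyp      = hyp₀
  deduction (thm b)  = theorem b
  deduction (mp p q) = app (deduction q) (deduction p)


-- Linearity is read off a projective unifier of p ∨ q: it proves ε p ∨ ε q, while
-- p ∨ q ⊢ ε p ⇔ p turns ε p into p ∨ q ⇒ p, that is into q ⇒ p.
projective⇒linear : ∀ {L} → IntermediateLogic L → ProjectiveUnification L →
  ∀ A B → L ((A ⇒ B) ∨ (B ⇒ A))
projective⇒linear {L} IL proj A B = linear (proj (var 0 ∨ var 1) ((λ _ → ⊤') , proved (inl truth)))
  where
  open Entailment IL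
  linear : Σ Subst (Projective L (var 0 ∨ var 1)) → L ((A ⇒ B) ∨ (B ⇒ A))
  linear (ε , unifies , identity) = substitute (λ { 0 → A ; _ → B }) {(var 0 ⇒ var 1) ∨ (var 1 ⇒ var 0)}
    (proved (cases (theorem unifies)
      (inr (lam (⇔-to (cut (inr v₀) (deduction (identity 0))) (wk v₀))))
      (inl (lam (⇔-to (cut (inl v₀) (deduction (identity 1))) (wk v₀))))))

-- The Gödel algebra on ℕ ∪ {∞} and its formula levels.

compare : (i j : ℕ ⁺) → i ≤⁺ j ⊎ j <⁺ i
compare i j with <⁺-cmp-≡ <-cmp i j
compare _ _ | tri< [ p ] _ _    = inj₁ [ <⇒≤ p ]
compare _ _ | tri< [ k ]<⊤⁺ _ _ = inj₁ ([ k ] ≤⊤⁺)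
compare [ k ] _ | tri≈ _ refl _ = inj₁ [ ≤-reflexive refl ]
compare ⊤⁺ _    | tri≈ _ refl _ = inj₁ (⊤⁺ ≤⊤⁺)
compare _ _ | tri> _ _ p        = inj₂ p

-- Implication on a Gödel chain is ⊤ if i ≤ j and j if j < i, hence the weak/strict split made by
-- `compare`.
meet join residual : ℕ ⁺ → ℕ ⁺ → ℕ ⁺
meet i j     = [ (λ _ → i)  , (λ _ → j) ]′ (compare i j)
join i j     = [ (λ _ → j)  , (λ _ → i) ]′ (compare i j)
residual i j = [ (λ _ → ⊤⁺) , (λ _ → j) ]′ (compare i j)

value : (ℕ → ℕ ⁺) → Fm → ℕ ⁺
value w (var x) = w x
value w ⊥'      = [ 0 ]
value w (A ∧ B) = meet (value w A) (value w B)
value w (A ∨ B) = join (value w A) (value w B)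
value w (A ⇒ B) = residual (value w A) (value w B)

-- On a Gödel chain, level k is the k-th smallest value above ⊥ of the variables in xs
-- (⊤ if there is none): (x ⇒ θ) ∨ x is ⊤ if x ≤ θ and x otherwise.
level : List ℕ → ℕ → Fm
level xs zero    = ⊥'
level xs (suc k) = ⋀ xs (λ x → (var x ⇒ level xs k) ∨ var x)

level⁺ : List ℕ → ℕ ⁺ → Fm
level⁺ xs [ k ] = level xs k
level⁺ xs ⊤⁺    = ⊤'

-- Levels as a chain on which the connectives compute.

module Levels {L : Logic} (IL : IntermediateLogic L) (xs : List ℕ) where
  open Entailment IL

  θ : ℕ → Fm
  θ = level xs

  θ⁺ : ℕ ⁺ → Fm
  θ⁺ = level⁺ xs

  θ-suc : ∀ {k} → θ k ⊢ θ (suc k)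
  θ-suc = ⋀-intro xs (λ _ → inl (lam (wk hyp₀)))

  θ-mono′ : ∀ {i j} → i ≤′ j → θ i ⊢ θ j
  θ-mono′ ≤′-refl                 = hyp₀
  θ-mono′ {j = suc k} (≤′-step p) = cut (θ-mono′ p) (θ-suc {k})

  θ⁺-mono : ∀ {i j} → i ≤⁺ j → θ⁺ i ⊢ θ⁺ j
  θ⁺-mono [ p ]    = θ-mono′ (≤⇒≤′ p)
  θ⁺-mono (_ ≤⊤⁺) = truth

  -- A ↦ (A ⇒ C) ⇒ C preserves finite meets.
  ⋀-dense : ∀ {Γ C f} ys → (∀ x → Γ ⊢ (f x ⇒ C) ⇒ C) → Γ ⊢ (⋀ ys f ⇒ C) ⇒ C
  ⋀-dense []       h = lam (app v₀ truth)
  ⋀-dense (y ∷ ys) h = lam (app (wk (h y)) (lam (app (wk (wk (⋀-dense ys h)))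
    (lam (app (wk (wk v₀)) (pair (wk v₀) v₀))))))

  -- Each conjunct C of the upper level has this property: C ⇒ θ k yields x ⇒ θ k through the right
  -- disjunct, hence C through the left one, hence θ k.
  θ-drop : ∀ {Γ k} → Γ ⊢ (θ (suc k) ⇒ θ k) ⇒ θ k
  θ-drop = ⋀-dense xs (λ _ → lam (app v₀ (inl (lam (app (wk v₀) (inr v₀))))))

  θ⁺-drop : ∀ {i j} → j <⁺ i → θ⁺ i ⇒ θ⁺ j ⊢ θ⁺ j
  θ⁺-drop {j = [ k ]} [ p ] = app (θ-drop {k = k}) (lam (app (wk hyp₀) (cut v₀ (θ-mono′ (≤⇒≤′ p)))))
  θ⁺-drop [ k ]<⊤⁺          = app hyp₀ truth

  θ⁺-< : ∀ {i j} → j <⁺ i → θ⁺ j ⊢ θ⁺ i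
  θ⁺-< [ p ]    = θ⁺-mono [ <⇒≤ p ]
  θ⁺-< [ k ]<⊤⁺ = truth

  θ⁺-meet : ∀ {Γ} i j → Γ ⊢ θ⁺ i ∧ θ⁺ j ⇔ θ⁺ (meet i j)
  θ⁺-meet i j with compare i j
  ... | inj₁ p = ⇔-intro (fst v₀) (pair v₀ (cut v₀ (θ⁺-mono p)))
  ... | inj₂ p = ⇔-intro (snd v₀) (pair (cut v₀ (θ⁺-< p)) v₀)

  θ⁺-join : ∀ {Γ} i j → Γ ⊢ θ⁺ i ∨ θ⁺ j ⇔ θ⁺ (join i j)
  θ⁺-join i j with compare i j
  ... | inj₁ p = ⇔-intro (cases v₀ (cut v₀ (θ⁺-mono p)) v₀) (inr v₀)
  ... | inj₂ p = ⇔-intro (cases v₀ v₀ (cut v₀ (θ⁺-< p))) (inl v₀)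

  θ⁺-residual : ∀ {Γ} i j → Γ ⊢ (θ⁺ i ⇒ θ⁺ j) ⇔ θ⁺ (residual i j)
  θ⁺-residual i j with compare i j
  ... | inj₁ p = ⇔-intro truth (theorem (θ⁺-mono p))
  ... | inj₂ p = ⇔-intro (cut v₀ (θ⁺-drop p)) (lam (wk v₀))

  -- By the three preceding lemmas `θ⁺` is a homomorphism up to provable equivalence; level 0 is ⊥'
  -- by definition.
  θ⁺-value : ∀ {Γ} w A → Γ ⊢ sub (θ⁺ ∘ w) A ⇔ θ⁺ (value w A)
  θ⁺-value w (var x) = ⇔-refl
  θ⁺-value w ⊥'      = ⇔-refl
  θ⁺-value w (A ∧ B) = ⇔-trans (∧-cong (θ⁺-value w A) (θ⁺-value w B)) (θ⁺-meet (value w A) (value w B))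
  θ⁺-value w (A ∨ B) = ⇔-trans (∨-cong (θ⁺-value w A) (θ⁺-value w B)) (θ⁺-join (value w A) (value w B))
  θ⁺-value w (A ⇒ B) = ⇔-trans (⇒-cong (θ⁺-value w A) (θ⁺-value w B)) (θ⁺-residual (value w A) (value w B))

  -- Case analysis in a linear logic.

  module Linear (linear : ∀ A B → L ((A ⇒ B) ∨ (B ⇒ A))) where

    Sorted : Fm → List ℕ → Set
    Sorted Γ = AllPairs (λ x y → Γ ⊢ var x ⇒ var y)

    Sorted-mono : ∀ {Γ Δ ys} → Δ ⊢ Γ → Sorted Γ ys → Sorted Δ ys
    Sorted-mono s = AllPairs.map (cut s)

    -- Insertion sort inside a derivation: each comparison is a case split on linearity, and the
    -- continuation works in the extended context.
    insert-cases : ∀ {C Γ} x ys → Sorted Γ ys →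
      (∀ {Δ zs} → Δ ⊢ Γ → Sorted Δ zs → zs ↭ x ∷ ys → Δ ⊢ C) → Γ ⊢ C
    insert-cases x []       _        k = k hyp₀ ([] ∷ []) ↭-refl
    insert-cases x (y ∷ ys) (p ∷ ps) k = cases (theorem (linear (var x) (var y)))
      (k (wk hyp₀)
         ((v₀ ∷ All.map (λ q → lam (app (wk (wk q)) (app (wk v₀) v₀))) p) ∷ Sorted-mono (wk hyp₀) (p ∷ ps))
         ↭-refl)
      (insert-cases x ys (Sorted-mono (wk hyp₀) ps)
        (λ s sorted π → k (cut s (wk hyp₀))
          (All-resp-↭ (↭-sym π) (cut s v₀ ∷ All.map (cut (cut s (wk hyp₀))) p) ∷ sorted)
          (↭-trans (prep y π) (swap y x ↭-refl))))

    sort-cases : ∀ {C Γ} ys →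
      (∀ {Δ zs} → Δ ⊢ Γ → Sorted Δ zs → zs ↭ ys → Δ ⊢ C) → Γ ⊢ C
    sort-cases []       k = k hyp₀ [] ↭-refl
    sort-cases (y ∷ ys) k = sort-cases ys (λ {_} {zs} s sorted π →
      insert-cases y zs sorted (λ s′ sorted′ π′ → k (cut s′ s) sorted′ (↭-trans π′ (prep y π))))

    -- Linearity is applied to A and A ⇒ B: A ⇒ A ⇒ B contracts, and (A ⇒ B) ⇒ A gives B once A ⇒ B
    -- is assumed.
    compare-cases : ∀ {Γ} A B → Γ ⊢ (A ⇒ B) ∨ ((A ⇒ B) ⇒ B)
    compare-cases A B = cases (theorem (linear A (A ⇒ B)))
      (inl (lam (app (app (wk v₀) v₀) v₀)))
      (inr (lam (app v₀ (app (wk v₀) v₀))))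

    Levelled : Fm → Set
    Levelled Γ = ∀ {x} → x ∈ xs → Σ (ℕ ⁺) λ i → Γ ⊢ var x ⇔ θ⁺ i

    -- Invariant: the pending sorted variables `ys` lie above θ k, and all others lie below it with
    -- a level already assigned. The least pending y either equals θ k or, being strictly above it,
    -- equals θ (k+1).
    level-cases : ∀ {C Γ} k ys → Sorted Γ ys → All (_∈ xs) ys → All (λ y → Γ ⊢ θ k ⇒ var y) ys →
      (∀ {x} → x ∈ xs → x ∈ ys ⊎ (Γ ⊢ var x ⇒ θ k) × Σ (ℕ ⁺) λ i → Γ ⊢ var x ⇔ θ⁺ i) →
      (∀ {Δ} → Δ ⊢ Γ → Levelled Δ → Δ ⊢ C) → Γ ⊢ C
    level-cases k [] _ _ _ done c = c hyp₀ λ m → [ (λ ()) , proj₂ ]′ (done m)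
    level-cases k (y ∷ ys) (p ∷ ps) (y∈xs ∷ ∈xs) (b ∷ bs) done c =
      cases (compare-cases (var y) (θ k))
        (level-cases k ys (Sorted-mono (wk hyp₀) ps) ∈xs (All.map wk bs)
          (λ m → [ (λ { (here refl) → inj₂ (v₀ , [ k ] , pair v₀ (wk b)) ; (there n) → inj₁ n })
                 , (λ (l , i , e) → inj₂ (wk l , i , wk e)) ]′ (done m))
          (λ s → c (cut s (wk hyp₀))))
        (level-cases (suc k) ys (Sorted-mono (wk hyp₀) ps) ∈xs
          (All.map (λ q → lam (app (wk (wk q)) (app (wk next⇒y) v₀))) p)
          (λ m → [ (λ { (here refl) → inj₂ (y⇒next , [ suc k ] , pair y⇒next next⇒y) ; (there n) → inj₁ n })
                 , (λ (l , i , e) → inj₂ (lam (cut (app (wk (wk l)) v₀) (θ-suc {k})) , i , wk e)) ]′ (done m))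
          (λ s → c (cut s (wk hyp₀))))
      where
      next⇒y : _ ∧ ((var y ⇒ θ k) ⇒ θ k) ⊢ θ (suc k) ⇒ var y
      next⇒y = lam (cases (cut v₀ (⋀-elim y∈xs)) (app (wk (wk (wk b))) (app (wk (wk v₀)) v₀)) v₀)
      -- Pending variables satisfy their conjunct by the right disjunct, as they lie above y;
      -- finished ones by the left.
      y⇒next : _ ∧ ((var y ⇒ θ k) ⇒ θ k) ⊢ var y ⇒ θ (suc k)
      y⇒next = lam (⋀-intro xs λ m →
        [ (λ { (here refl) → inr v₀ ; (there n) → inr (app (wk (wk (All.lookup p n))) v₀) })
        , (λ (l , _) → inl (wk (wk l))) ]′ (done m))

    levelled-cases : ∀ {C Γ} → (∀ {Δ} → Levelled Δ → Δ ⊢ C) → Γ ⊢ C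
    levelled-cases k = sort-cases xs λ {_} {zs} _ sorted π →
      level-cases 0 zs sorted (All.tabulate (∈-resp-↭ π)) (All.tabulate (λ _ → theorem (axiom (ax-⊥E _))))
        (λ m → inj₁ (∈-resp-↭ (↭-sym π) m)) (λ _ → k)

-- A levelled context determines a valuation `w` under which A equals the level of its value, and
-- that value is at least i. Linearity reduces the claim to such contexts.
level⇒formula : ∀ {L} → IntermediateLogic L → (∀ A B → L ((A ⇒ B) ∨ (B ⇒ A))) →
  ∀ A {i} → (∀ w → i ≤⁺ value w A) → L (level⁺ (vars A) i ⇒ A)
level⇒formula {L} IL linear A {i} bound = proved (levelled-cases reduce)
  where
  open Entailment IL
  open Levels IL (vars A)
  open Linear linear
  reduce : ∀ {Δ} → Levelled Δ → Δ ⊢ θ⁺ i ⇒ A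
  reduce {Δ} at = lam (⇔-from (wk formula) (cut v₀ (θ⁺-mono (bound w))))
    where
    choose : ∀ x → Dec (x ∈ vars A) → ℕ ⁺
    choose x (yes m) = proj₁ (at m)
    -- An arbitrary default: variables outside A do not affect its value.
    choose x (no _)  = ⊤⁺
    w : ℕ → ℕ ⁺
    w x = choose x (x ∈? vars A)
    variable-level : ∀ {x} → x ∈ vars A → (d : Dec (x ∈ vars A)) → Δ ⊢ var x ⇔ θ⁺ (choose x d)
    variable-level _ (yes m) = proj₂ (at m)
    variable-level m (no ∉)  = contradiction m ∉
    formula : Δ ⊢ A ⇔ θ⁺ (value w A)
    formula = ⇔-trans (⇔-reflexive (sym (sub-var A)))
      (⇔-trans (sub-⇔ A (λ {x} m → variable-level m (x ∈? vars A))) (θ⁺-value w A))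

-- Least values and the controlling theorem.

least : ExcludedMiddle 0ℓ → (P : ℕ → Set) → ∀ n → P n → Σ ℕ λ m → P m × (∀ k → P k → m ≤ k)
least em P = <-rec _ step
  where
  step : ∀ n → (∀ {m} → m < n → P m → Σ ℕ λ m → P m × (∀ k → P k → m ≤ k)) →
    P n → Σ ℕ λ m → P m × (∀ k → P k → m ≤ k)
  step n rec p with em {Σ ℕ λ k → P k × k < n}
  ... | yes (k , q , k<n) = rec k<n q
  ... | no minimal        = n , p , λ k q → ≮⇒≥ (λ k<n → minimal (k , q , k<n))

least⁺ : ExcludedMiddle 0ℓ → (P : ℕ ⁺ → Set) → ∀ i → P i → Σ (ℕ ⁺) λ m → P m × (∀ j → P j → m ≤⁺ j)
least⁺ em P [ n ] p with least em (P ∘ [_]) n p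
... | m , q , minimal = [ m ] , q , λ { [ k ] r → [ minimal k r ] ; ⊤⁺ _ → [ m ] ≤⊤⁺ }
least⁺ em P ⊤⁺ p with em {Σ ℕ λ n → P [ n ]}
... | yes (n , q) = least⁺ em P [ n ] q
... | no infinite = ⊤⁺ , p , λ { [ k ] r → contradiction (k , r) infinite ; ⊤⁺ _ → ⊤⁺ ≤⊤⁺ }

-- D ∈ L attains the least value of a theorem of L; the shortest Gödel chain refuting D
-- is then at most as long as any chain refuting F, and a substitution by levels
-- transports the former into the latter.
axiom-over-linear : ExcludedMiddle 0ℓ → ∀ {L L'} → IntermediateLogic L → IntermediateLogic L' →
  (∀ A B → L' ((A ⇒ B) ∨ (B ⇒ A))) →
  Σ Fm λ D → L D × (∀ F → L F → Σ Subst λ δ → L' (sub δ D ⇒ F))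
axiom-over-linear em {L} {L'} IL IL' linear
  with least⁺ em (λ i → Σ Fm λ D → L D × Σ (ℕ → ℕ ⁺) λ w → value w D ≡ i)
         ⊤⁺ (⊤' , Entailment.proved IL (Entailment.truth IL) , (λ _ → ⊤⁺) , refl)
... | _ , (D , d , w , refl) , minimal = D , d , λ F f →
  (level⁺ (vars F) ∘ w) ,
  cut (⇔-to (Levels.θ⁺-value IL' (vars F) w D) hyp₀)
      (level⇒formula IL' linear F (λ w′ → minimal (value w′ F) (F , f , w′ , refl)))
  where open Entailment IL'

-- Three disjoint sorts of variables.

data Var : Set where
  X Y Z : ℕ → Var

next : Var → Var
next (X n) = X (suc n)
next (Y n) = Y (suc n)
next (Z n) = Z (suc n)

-- The residue modulo 3 is the sort, the quotient the index.
decode : ℕ → Var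
decode 0                   = X 0
decode 1                   = Y 0
decode 2                   = Z 0
decode (suc (suc (suc n))) = next (decode n)

encode : Var → ℕ
encode (X zero)    = 0
encode (Y zero)    = 1
encode (Z zero)    = 2
encode (X (suc n)) = suc (suc (suc (encode (X n))))
encode (Y (suc n)) = suc (suc (suc (encode (Y n))))
encode (Z (suc n)) = suc (suc (suc (encode (Z n))))

decode-encode : ∀ v → decode (encode v) ≡ v
decode-encode (X zero)    = refl
decode-encode (Y zero)    = refl
decode-encode (Z zero)    = refl
decode-encode (X (suc n)) = cong next (decode-encode (X n))
decode-encode (Y (suc n)) = cong next (decode-encode (Y n))
decode-encode (Z (suc n)) = cong next (decode-encode (Z n))

encode-next : ∀ v → encode (next v) ≡ suc (suc (suc (encode v)))
encode-next (X n) = refl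
encode-next (Y n) = refl
encode-next (Z n) = refl

encode-decode : ∀ c → encode (decode c) ≡ c
encode-decode 0                   = refl
encode-decode 1                   = refl
encode-decode 2                   = refl
encode-decode (suc (suc (suc c))) =
  trans (encode-next (decode c)) (cong (λ n → suc (suc (suc n))) (encode-decode c))

copy : (ℕ → Var) → Subst
copy V j = var (encode (V j))

assign : Subst → Subst → Subst → Subst
assign f g h c = at (decode c)
  where
  at : Var → Fm
  at (X j) = f j
  at (Y j) = g j
  at (Z j) = h j

module _ (f g h : Subst) where

  assign-X : ∀ j → assign f g h (encode (X j)) ≡ f j
  assign-X j rewrite decode-encode (X j) = refl

  assign-Y : ∀ j → assign f g h (encode (Y j)) ≡ g j
  assign-Y j rewrite decode-encode (Y j) = refl

  assign-Z : ∀ j → assign f g h (encode (Z j)) ≡ h j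
  assign-Z j rewrite decode-encode (Z j) = refl

  sub-assign-X : ∀ A → sub (assign f g h) (sub (copy X) A) ≡ sub f A
  sub-assign-X A = trans (sub-∘ _ _ A) (sub-cong A (λ {j} _ → assign-X j))

  sub-assign-Y : ∀ A → sub (assign f g h) (sub (copy Y) A) ≡ sub g A
  sub-assign-Y A = trans (sub-∘ _ _ A) (sub-cong A (λ {j} _ → assign-Y j))

  sub-assign-Z : ∀ A → sub (assign f g h) (sub (copy Z) A) ≡ sub h A
  sub-assign-Z A = trans (sub-∘ _ _ A) (sub-cong A (λ {j} _ → assign-Z j))

-- From one unifier over L to one over L ∩ L'.

module Lift {L L' : Logic} (IL : IntermediateLogic L) (IL' : IntermediateLogic L')
  {A D : Fm} (D∈L : L D) {ε : Subst} (ε-unifies : Unifier L A ε) where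

  private module L = Entailment IL
  open Entailment IL'

  -- Variables outside A stay fixed, so the finite conjunction `graph` suffices to identify `ε̂`
  -- with the identity on all variables.
  image : ∀ j → Dec (j ∈ vars A) → Fm
  image j (yes _) = sub (copy Y) (ε j)
  image j (no _)  = copy X j

  ε̂ : Subst
  ε̂ = assign (λ j → image j (j ∈? vars A)) (copy Y) (copy Z)

  ε̂-X : ∀ j → ε̂ (encode (X j)) ≡ image j (j ∈? vars A)
  ε̂-X = assign-X _ _ _

  image-∈ : ∀ {j} → j ∈ vars A → (d : Dec (j ∈ vars A)) → image j d ≡ sub (copy Y) (ε j)
  image-∈ m (yes _) = refl
  image-∈ m (no ∉)  = contradiction m ∉

  ε̂-vars : ∀ {j} → j ∈ vars A → ε̂ (encode (X j)) ≡ sub (copy Y) (ε j)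
  ε̂-vars {j} m = trans (ε̂-X j) (image-∈ m (j ∈? vars A))

  ε̂-unifies : L (sub ε̂ (sub (copy X) A))
  ε̂-unifies = subst L
    (sym (trans (sub-∘ _ _ A) (trans (sub-cong A ε̂-vars) (sym (sub-∘ _ _ A)))))
    (L.substitute (copy Y) ε-unifies)

  graph : Fm
  graph = ⋀ (vars A) (λ j → copy X j ⇔ sub (copy Y) (ε j))

  graph-ε̂ : ∀ c → graph ⊢ var c ⇔ ε̂ c
  graph-ε̂ c = subst (λ c → graph ⊢ var c ⇔ ε̂ c) (encode-decode c) (on (decode c))
    where
    on-image : ∀ j d → graph ⊢ copy X j ⇔ image j d
    on-image j (yes m) = ⋀-elim m
    on-image j (no _)  = ⇔-refl
    on : ∀ v → graph ⊢ var (encode v) ⇔ ε̂ (encode v)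
    on (X j) = ⇔-trans (on-image j (j ∈? vars A)) (⇔-reflexive (sym (ε̂-X j)))
    on (Y j) = ⇔-reflexive (sym (assign-Y _ _ _ j))
    on (Z j) = ⇔-reflexive (sym (assign-Z _ _ _ j))

  -- Since `ε̂` fixes the Y variables, it makes the two sides of each conjunct literally equal.
  ε̂-graph : ∀ {Γ} → Γ ⊢ sub ε̂ graph
  ε̂-graph = subst (_ ⊢_) (sym (sub-⋀ ε̂ (vars A) _))
    (⋀-intro (vars A) (λ {j} m → ⇔-reflexive
      (trans (ε̂-vars m) (sym (sub-assign-Y _ _ _ (ε j))))))

  B : Fm
  B = (sub (copy Z) D ⇒ graph) ∧ sub (copy X) A

  module Combined {π : Subst} (π-projective : Projective L' B π) where

    ρ : Subst
    ρ c = glue (sub (copy Z) D) (var c) (ε̂ c)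

    ρ-ε̂ : ∀ c → sub (copy Z) D ⊢ ρ c ⇔ ε̂ c
    ρ-ε̂ c = glue-right hyp₀

    -- Under B, D implies the graph and so c ⇔ ε̂ c, which is the condition for `glue` to return its
    -- left argument.
    ρ-id : ∀ c → B ⊢ ρ c ⇔ var c
    ρ-id c = glue-left (lam (cut (app (wk (fst hyp₀)) v₀) (graph-ε̂ c)))

    π-id : ∀ c → B ⊢ π c ⇔ var c
    π-id c = deduction (proj₂ π-projective c)

    τ : Subst
    τ = ρ ∘ˢ π

    τ-unifies : L' (sub τ B)
    τ-unifies = subst L' (sub-∘ ρ π B) (substitute ρ (proj₁ π-projective))

    τ-id : ∀ c → B ⊢ τ c ⇔ var c
    τ-id c = ⇔-trans (sub-⇔ (π c) (λ {x} _ → ρ-id x))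
      (⇔-trans (⇔-reflexive (sub-var (π c))) (π-id c))

    -- The switch for the second gluing: a theorem of L which in L' entails that `τ` and `ε̂` agree.
    E : Fm
    E = sub (copy Z) D ∧ sub ε̂ (sub (copy X) A)

    E∈L : L E
    E∈L = L.proved (L.pair (L.theorem (L.substitute (copy Z) D∈L)) (L.theorem ε̂-unifies))

    E-ρB : E ⊢ sub ρ B
    E-ρB = ⇔-from (sub-⇔ B (λ {c} _ → cut (fst hyp₀) (ρ-ε̂ c))) (pair (lam ε̂-graph) (snd hyp₀))

    -- Applying `ρ` to B ⊢ π c ⇔ c gives ρ B ⊢ τ c ⇔ ρ c. E entails ρ B, and its conjunct D turns ρ
    -- c into ε̂ c.
    τ-ε̂ : ∀ c → E ⊢ τ c ⇔ ε̂ c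
    τ-ε̂ c = ⇔-trans (cut E-ρB (substitute ρ (π-id c))) (cut (fst hyp₀) (ρ-ε̂ c))

    ν : Subst
    ν j = glue E (τ (encode (X j))) (ε̂ (encode (X j)))

    ν-in-L : ∀ j → L (ν j ⇔ ε̂ (encode (X j)))
    ν-in-L j = L.proved (L.glue-right (L.theorem E∈L))

    ν-in-L' : ∀ j → L' (ν j ⇔ τ (encode (X j)))
    ν-in-L' j = proved (glue-left (theorem (τ-ε̂ _)))

    ν-unifies : Unifier (L ∩ L') A ν
    ν-unifies =
      L.proved (L.⇔-from (L.sub-⇔ A (λ {j} _ → L.theorem (ν-in-L j)))
        (L.theorem (subst L (sub-∘ _ _ A) ε̂-unifies))) ,
      proved (⇔-from (sub-⇔ A (λ {j} _ → theorem (ν-in-L' j)))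
        (snd (theorem (subst (λ C → L' (sub τ (sub (copy Z) D ⇒ graph) ∧ C)) (sub-∘ _ _ A) τ-unifies))))

  module Instance {μ α : Subst} (μ-unifies : Unifier L' A μ) (αε : ∀ x → L ((α ∘ˢ ε) x ⇔ μ x)) where

    -- Restricting to the variables of A packs the equivalences into one theorem of L, which a
    -- single instance of D can force in L'.
    αε-graph : Fm
    αε-graph = ⋀ (vars A) (λ j → μ j ⇔ sub α (ε j))

    αε-graph∈L : L αε-graph
    αε-graph∈L = L.proved (L.⋀-intro (vars A) (λ {j} _ → L.⇔-sym (L.theorem (αε j))))

    module _ {δ : Subst} (δ-forces : L' (sub δ D ⇒ αε-graph)) where

      β : Subst
      β = assign μ α δ

      β-unifies : L' (sub β B)
      β-unifies = proved (pair
        (theorem (subst (_⊢ sub β graph) (sym (sub-assign-Z μ α δ D)) (cut δ-forces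
          (subst (αε-graph ⊢_) (sym (sub-⋀ β (vars A) _)) (⋀-intro (vars A) (λ {j} m →
            ⇔-trans (⇔-reflexive (assign-X μ α δ j))
              (⇔-trans (⋀-elim m) (⇔-reflexive (sym (sub-assign-Y μ α δ (ε j)))))))))))
        (theorem (subst L' (sym (sub-assign-X μ α δ A)) μ-unifies)))

      module _ {π : Subst} (π-projective : Projective L' B π) where
        open Combined π-projective

        ν≼μ : ν ≼[ L ∩ L' ] μ
        ν≼μ = β , λ j →
          L.proved (L.⇔-trans (L.theorem (L.substitute β (ν-in-L j)))
            (L.⇔-trans (L.⇔-reflexive (cong (sub β) (ε̂-X j))) (on-image j (j ∈? vars A)))) ,
          proved (⇔-trans (theorem (substitute β (ν-in-L' j)))
            -- As β B holds in L', the β-image of B ⊢ τ c ⇔ c collapses β ∘ τ to β, whose X part is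
            -- μ.
            (⇔-trans (cut (theorem β-unifies) (substitute β (τ-id (encode (X j)))))
              (⇔-reflexive (assign-X μ α δ j))))
          where
          on-image : ∀ j d → ⊤' L.⊢ sub β (image j d) ⇔ μ j
          on-image j (yes _) = L.⇔-trans (L.⇔-reflexive (sub-assign-Y μ α δ (ε j))) (L.theorem (αε j))
          on-image j (no _)  = L.⇔-reflexive (assign-X μ α δ j)

-- Complete sets of unifiers for the intersection.

module _ (em : ExcludedMiddle 0ℓ) {L L' : Logic}
  (IL : IntermediateLogic L) (IL' : IntermediateLogic L') (proj : ProjectiveUnification L') where

  Refines : Fm → List Subst → List Subst → Set
  Refines A Es Ns = ∀ {μ ε} → Unifier (L ∩ L') A μ → ε ∈ Es → ε ≼[ L ] μ →
    Σ Subst λ ν → ν ∈ Ns × ν ≼[ L ∩ L' ] μ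

  refine : ∀ A Es → (∀ {ε} → ε ∈ Es → Unifier L A ε) →
    Σ (List Subst) λ Ns → (∀ {ν} → ν ∈ Ns → Unifier (L ∩ L') A ν) × Refines A Es Ns
  refine A []       unifies = [] , (λ ()) , (λ _ ())
  refine A (ε ∷ Es) unifies
    with axiom-over-linear em IL IL' (projective⇒linear IL' proj) | refine A Es (unifies ∘ there)
  ... | D , D∈L , forces | Ns , Ns-unify , refines = extend em
    where
    open Lift IL IL' {A} D∈L (unifies (here refl))
    extend : Dec (Unifiable L' B) →
      Σ (List Subst) λ Ns → (∀ {ν} → ν ∈ Ns → Unifier (L ∩ L') A ν) × Refines A (ε ∷ Es) Ns
    extend (yes unifiable) with proj B unifiable
    ... | π , π-projective = (ν ∷ Ns) ,
      (λ { (here refl) → ν-unifies ; (there m) → Ns-unify m }) ,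
      λ { (_ , u) (here refl) (α , αε) → let open Instance u αε in
            ν , here refl , ν≼μ (proj₂ (forces αε-graph αε-graph∈L)) π-projective
        ; u (there m) ≼ → let (ν′ , n , ≼′) = refines u m ≼ in ν′ , there n , ≼′ }
      where open Combined π-projective
    -- Any common unifier that is an L-instance of ε would unify B through `β`, so ε contributes
    -- nothing.
    extend (no ununifiable) = Ns , Ns-unify ,
      λ { (_ , u) (here refl) (α , αε) → let open Instance u αε in
            contradiction (_ , β-unifies (proj₂ (forces αε-graph αε-graph∈L))) ununifiable
        ; u (there m) ≼ → refines u m ≼ }

finite-complete-sets : ∀ {L} → Finitary L ⊎ Unitary L →
  ∀ A → Unifiable L A → Σ (List Subst) (CompleteSet L A)
finite-complete-sets (inj₁ (_ , complete)) = complete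
finite-complete-sets (inj₂ unitary) A u with unitary A u
... | ε , unifies , general = (ε ∷ []) , (λ { (here refl) → unifies }) ,
  λ μ v → ε , here refl , general μ v

theorem5p11 : ExcludedMiddle 0ℓ → (L L' : Logic) →
    IntermediateLogic L → IntermediateLogic L' →
    LocallyTabular L → (Finitary L ⊎ Unitary L) →
    ProjectiveUnification L' →
    Finitary (L ∩ L') ⊎ Unitary (L ∩ L')
-- `Finitary` includes non-unitarity, so excluded middle selects the disjunct.
theorem5p11 em L L' IL IL' _ finite proj with em {Unitary (L ∩ L')}
... | yes unitary    = inj₂ unitary
... | no non-unitary = inj₁ (non-unitary , complete)
  where
  complete : ∀ A → Unifiable (L ∩ L') A → Σ (List Subst) (CompleteSet (L ∩ L') A)
  complete A (σ , u , _) with finite-complete-sets {L} finite A (σ , u)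
  ... | Es , Es-unify , covers with refine em IL IL' proj A Es Es-unify
  ...   | Ns , Ns-unify , refines = Ns , Ns-unify , λ μ v →
    let (_ , m , ≼) = covers μ (proj₁ v) in refines v m ≼
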